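{- Let $k\ge 1$, $n\ge 1$, $s\ge 1$ and $m_1,\dots,m_k\ge 1$ be integers, and put $\theta_j=m_j/s$ for $j=1,\dots,k$. Consider the $k$-cell urn model described in the context, and let $p(x_1,x_2,\dots,x_k;n)$ denote the probability that exactly $x_j$ balls of color $c_j$ are drawn from the $j$-th cell, for every $j=1,\dots,k$. Then for all integers $x_1,\dots,x_k\ge 1$ with $\sum_{j=1}^k x_j\le n$, and with $x_0=0$, $$p(x_1,x_2,\ldots,x_k;n)=\frac{\prod_{j=1}^k \theta_j^{x_j}}{\prod_{j=1}^k\left(\theta_j+n-\sum_{\nu=0}^{j-1}x_\nu-1\right)_{n-\sum_{\nu=0}^{j-1}x_\nu}}\cdot \sum \prod_{j=1}^k m_{j,1}m_{j,2}\cdots m_{j,\,n-\sum_{\nu=1}^j x_\nu},$$ where the multiple sum is extended over all choices, for each $j=1,\dots,k$, of an $\left(n-\sum_{\nu=1}^j x_\nu\right)$-combination (subset) $\{m_{j,1},m_{j,2},\ldots,m_{j,\,n-\sum_{\nu=1}^{j}x_\nu}\}$ of the $n-\sum_{\nu=0}^{j-1}x_\nu-1$ positive integers $\{1,2,\ldots,n-\sum_{\nu=0}^{j-1}x_\nu-1\}$.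
   Context: Urn model. There are $k$ cells; the $j$-th cell initially contains $m_j$ balls of color $c_j$ and no red balls, $j=1,\dots,k$. First, $n$ balls are drawn successively, uniformly at random, from cell 1; after each draw the drawn ball is returned to cell 1 together with $s$ additional red balls. Let $x_1$ be the number of draws giving a ball of color $c_1$. Then $n-x_1$ balls are drawn successively from cell 2 by the same procedure (after each draw the drawn ball is returned to cell 2 together with $s$ red balls), and $x_2$ is the number of these draws giving color $c_2$. In general, given $x_1,\dots,x_{j-1}$, one draws $n-\sum_{\nu=0}^{j-1}x_\nu$ balls (with $x_0=0$) successively from cell $j$ by the same procedure, and $x_j$ is the number of these draws giving color $c_j$. The draws are independent events: at the $i$-th draw from cell $j$, the probability of color $c_j$ is $\frac{\theta_j}{\theta_j+i-1}$ and the probability of red is $\frac{i-1}{\theta_j+i-1}$, with $\theta_j=m_j/s$. Notation: $(t)_N=t(t-1)\cdots(t-N+1)$ is the falling factorial of order $N$, with $(t)_0=1$. An empty product equals $1$. In the multiple sum, the subsets for different $j$ are chosen independently. (The double-indexed summation variables $m_{j,i}$ are unrelated to the initial ball counts $m_j$.) -}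

module Defs where

open import Data.Fin.Base using (Fin; zero; suc; toℕ)
open import Data.Integer.Base using (+_)
open import Data.List.Base as List using (List; []; _∷_; _++_)
open import Data.List.NonEmpty.Base as List⁺ using (List⁺; _⁺++_)
open import Data.Nat.ListAction using (sum)
open import Data.Nat.Base as ℕ using (ℕ; zero; suc; _∸_)
import Data.Nat.Properties as ℕ
import Data.Integer.Properties as ℤ
open import Data.Product.Base using (_×_; _,_)
open import Data.Rational.Base as ℚ
  using (ℚ; 0ℚ; 1ℚ; _+_; _*_; _-_; _/_; Positive; NonNegative)
import Data.Rational.Properties as ℚ
open import Data.Rational.Solver using (module +-*-Solver)
import Data.Rational.Unnormalised.Base as ℚᵘ
import Data.Rational.Unnormalised.Properties as ℚᵘ
open import Data.Vec.Base as Vec using (Vec; []; _∷_)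
open import Data.Vec.Functional using (Vector)
open import Data.Vec.Properties using (≡-dec)
open import Relation.Binary.PropositionalEquality
open import Relation.Nullary.Decidable using (does)
open import Relation.Unary using (Pred; Decidable)
open import Data.Bool.Base using (if_then_else_)
open import Level using (0ℓ)

open import Algebra.Definitions.RawSemiring ℚ.+-*-rawSemiring public
  using (_^_) renaming (product to ∏)

ι : ℕ → ℚ
ι n = + n / 1

-- A finitely supported distribution, as a list of (probability, outcome)
-- pairs; the same outcome may occur several times.
Dist : Set → Set
Dist A = List (ℚ × A)

private variable A B : Set

return : A → Dist A
return a = (1ℚ , a) ∷ []

infixl 1 _>>=_
_>>=_ : Dist A → (A → Dist B) → Dist B
d >>= f =
  List.concatMap (λ (v , a) → List.map (λ (w , b) → (v * w , b)) (f a)) d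

uniform : List⁺ A → Dist A
uniform as =
  List.map (λ a → (+ 1 / List⁺.length as , a)) (List⁺.toList as)

Pr : {P : Pred A 0ℓ} → Decidable P → Dist A → ℚ
Pr P? []            = 0ℚ
Pr P? ((w , a) ∷ d) = (if does (P? a) then w else 0ℚ) + Pr P? d

-- Cell j only ever contains balls of color c_j and red balls, so "own"
-- stands for c_j in cell j.
data Ball : Set where
  own red : Ball

Cell : Set
Cell = List⁺ Ball

initialCell : (m : ℕ) → .{{ℕ.NonZero m}} → Cell
initialCell (suc m) = own List⁺.∷ List.replicate m own

#own : Ball → ℕ
#own own = 1
#own red = 0

-- The number of balls of color "own" in N successive draws; after each draw
-- the drawn ball is put back together with s red balls.
draws : (s : ℕ) → Cell → (N : ℕ) → Dist ℕ
draws s cell zero    = return 0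
draws s cell (suc N) =
  uniform cell >>= λ b →
  draws s (cell ⁺++ List.replicate s red) N >>= λ x →
  return (#own b ℕ.+ x)

experiment : ∀ {k} (s : ℕ) → Vec Cell k → (n : ℕ) → Dist (Vec ℕ k)
experiment s []             n = return []
experiment s (cell ∷ cells) n =
  draws s cell n >>= λ x →
  experiment s cells (n ∸ x) >>= λ xs →
  return (x ∷ xs)

p : ∀ {k} (s : ℕ) (m : Vector ℕ k) → (∀ j → ℕ.NonZero (m j)) →
    Vector ℕ k → (n : ℕ) → ℚ
p s m m≢0 x n =
  Pr (λ y → ≡-dec ℕ._≟_ y (Vec.tabulate x))
     (experiment s (Vec.tabulate λ j → initialCell (m j) {{m≢0 j}}) n)

θ : ∀ {k} (s : ℕ) → .{{ℕ.NonZero s}} → Vector ℕ k → Vector ℚ k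
θ s m j = + m j / s

falling : ℚ → ℕ → ℚ
falling t zero    = 1ℚ
falling t (suc N) = t * falling (t - 1ℚ) N

-- With cells numbered from 1, j : Fin k is cell number i = suc (toℕ j), and
-- Σ< x j = x₀ + x₁ + ⋯ + x_{i-1} (where x₀ = 0), Σ≤ x j = x₁ + ⋯ + x_i.
Σ< Σ≤ : ∀ {k} → Vector ℕ k → Fin k → ℕ
Σ< x j = sum (List.take (toℕ j) (List.tabulate x))
Σ≤ x j = sum (List.take (suc (toℕ j)) (List.tabulate x))

total : ∀ {k} → Vector ℕ k → ℕ
total x = sum (List.tabulate x)

[1⋯_] : ℕ → List ℕ
[1⋯ M ] = List.applyUpTo suc M

-- All r-element subsets of a list of distinct elements, each exactly once,
-- as sublists.
combinations : ℕ → List A → List (List A)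
combinations zero    _        = [] ∷ []
combinations (suc r) []       = []
combinations (suc r) (a ∷ as) =
  List.map (a ∷_) (combinations r as) ++ combinations (suc r) as

-- All ways of choosing one element from each of k lists.
choices : ∀ {k} → Vec (List A) k → List (Vec A k)
choices []         = [] ∷ []
choices (as ∷ ass) = List.cartesianProductWith _∷_ as (choices ass)

∑-over : List A → (A → ℚ) → ℚ
∑-over as f = List.foldr _+_ 0ℚ (List.map f as)

-- ∸ is exact wherever total x ≤ n.
denominator : ∀ {k} (s : ℕ) → .{{ℕ.NonZero s}} →
              Vector ℕ k → Vector ℕ k → ℕ → ℚ
denominator s m x n =
  ∏ λ j → falling (θ s m j + ι (n ∸ Σ< x j) - 1ℚ) (n ∸ Σ< x j)

ι-suc : ∀ n → ι (suc n) ≡ 1ℚ + ι n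
ι-suc n = ℚ.toℚᵘ-injective (begin
  ℚ.toℚᵘ (ι (suc n))              ≈⟨ ℚ.toℚᵘ-fromℚᵘ (ℚᵘ.mkℚᵘ (+ suc n) 0) ⟩
  ℚᵘ.mkℚᵘ (+ suc n) 0             ≈⟨ ℚᵘ.*≡* (cong (λ i → (+ 1 ℤ.+ i) ℤ.* + 1) (sym (ℤ.*-identityʳ (+ n)))) ⟩
  ℚᵘ.1ℚᵘ ℚᵘ.+ ℚᵘ.mkℚᵘ (+ n) 0     ≈⟨ ℚᵘ.+-congʳ ℚᵘ.1ℚᵘ (ℚ.toℚᵘ-fromℚᵘ (ℚᵘ.mkℚᵘ (+ n) 0)) ⟨
  ℚᵘ.1ℚᵘ ℚᵘ.+ ℚ.toℚᵘ (ι n)        ≈⟨ ℚ.toℚᵘ-homo-+ 1ℚ (ι n) ⟨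
  ℚ.toℚᵘ (1ℚ + ι n)               ∎)
  where
  open import Relation.Binary.Reasoning.Setoid ℚᵘ.≃-setoid
  import Data.Integer.Base as ℤ

falling-pos : ∀ t .{{_ : Positive t}} N → Positive (falling (t + ι N - 1ℚ) N)
falling-pos t zero    = _
falling-pos t (suc N) =
  subst (λ u → Positive (u * falling (u - 1ℚ) N)) (sym shift)
    (ℚ.pos*pos⇒pos (t + ι N) {{t+N>0}}
                   (falling (t + ι N - 1ℚ) N) {{falling-pos t N}})
  where
  shift : t + ι (suc N) - 1ℚ ≡ t + ι N
  shift = trans (cong (λ u → t + u - 1ℚ) (ι-suc N))
                (solve 2 (λ a b → a :+ (con 1ℚ :+ b) :- con 1ℚ := a :+ b) refl t (ι N))
    where open +-*-Solver

  t+N>0 : Positive (t + ι N)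
  t+N>0 = subst Positive (ℚ.+-comm (ι N) t)
            (ℚ.nonNeg+pos⇒pos (ι N) {{ℚ.normalize-nonNeg N 1}} t)

∏-pos : ∀ {k} (f : Vector ℚ k) → (∀ j → Positive (f j)) → Positive (∏ f)
∏-pos {zero}  f f>0 = _
∏-pos {suc k} f f>0 =
  ℚ.pos*pos⇒pos (f zero) {{f>0 zero}}
    (∏ λ j → f (suc j)) {{∏-pos (λ j → f (suc j)) (λ j → f>0 (suc j))}}

denominator≢0 :
  ∀ {k} (s : ℕ) .{{_ : ℕ.NonZero s}} (m : Vector ℕ k) →
  (∀ j → ℕ.NonZero (m j)) → ∀ x n →
  ℚ.NonZero (denominator s m x n)
denominator≢0 s {{s≢0}} m m≢0 x n =
  ℚ.pos⇒nonZero (denominator s m x n) {{∏-pos _ λ j →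
    falling-pos (θ s m j) {{ℚ.normalize-pos (m j) s {{s≢0}} {{m≢0 j}}}} (n ∸ Σ< x j)}}

{-# OPTIONS --safe #-}

-- Conditioning on the outcome of each cell makes p the product over j of the
-- probabilities that n − x₁ − ⋯ − x_{j−1} draws from cell j give x_j own balls.
-- For a single cell, the joint law of N draws multiplied by θ(θ + 1)⋯(θ + N − 1)
-- has generating function ∏_{i < N} (θ u + i), whose coefficient at uˣ is
-- θˣ e_{N−x}(0, 1, …, N − 1) for the elementary symmetric polynomial e.  The
-- entry 0 contributes nothing, so this is the sum over combinations of
-- {1, …, N − 1}; the product of these sums over j is the multiple sum.
module Submission where

open import Defs
open import Data.Nat.ListAction using (product)
open import Data.Nat.Base using (ℕ; _≤_; _∸_; NonZero)
open import Data.Rational.Base using (_*_; _÷_)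
open import Data.Vec.Base using (lookup; tabulate)
open import Data.Vec.Functional using (Vector)
open import Relation.Binary.PropositionalEquality using (_≡_)

open import Algebra.Properties.CommutativeMonoid.Sum using (∑-distrib-+)
open import Algebra.Properties.Monoid.Sum using (sum-cong-≗)
open import Data.Bool.Base using (true; false; if_then_else_)
open import Data.Fin.Base using (zero; suc)
open import Data.Integer.Base as ℤ using (+_)
import Data.Integer.Properties as ℤ
open import Data.List.Base as List using (List; []; _∷_; _++_; length)
open import Data.List.Properties using (length-iterate)
open import Data.List.NonEmpty.Base as List⁺ using (toList)
open import Data.Nat.Base as ℕ using (zero; suc; z≤n; s≤s)
import Data.Nat.Properties as ℕ
open import Data.Product.Base using (_,_)
open import Data.Rational.Base as ℚ using (ℚ; 0ℚ; 1ℚ; _+_; _-_; _/_; 1/_)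
import Data.Rational.Properties as ℚ
open import Data.Rational.Solver using (module +-*-Solver)
import Data.Rational.Unnormalised.Base as ℚᵘ
import Data.Rational.Unnormalised.Properties as ℚᵘ
import Data.Vec.Base as Vec
open import Data.Vec.Properties using (≡-dec)
open import Function.Base using (_∘_; const)
open import Level using (0ℓ)
open import Relation.Binary.PropositionalEquality
  using (refl; sym; trans; cong; cong₂; module ≡-Reasoning)
open import Relation.Nullary.Decidable using (Dec; does; _×-dec_; yes; no)
open import Relation.Unary using (Pred; Decidable)

open +-*-Solver using (solve; _:+_; _:*_; _:-_; _:=_; con)
open ≡-Reasoning

private variable A B : Set

-- Naturals inside the rationals, and clearing of denominators.

ι-+ : ∀ a b → ι (a ℕ.+ b) ≡ ι a + ι b
ι-+ zero    b = sym (ℚ.+-identityˡ (ι b))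
ι-+ (suc a) b = begin
  ι (suc (a ℕ.+ b))  ≡⟨ ι-suc (a ℕ.+ b) ⟩
  1ℚ + ι (a ℕ.+ b)   ≡⟨ cong (λ q → 1ℚ + q) (ι-+ a b) ⟩
  1ℚ + (ι a + ι b)   ≡⟨ ℚ.+-assoc 1ℚ (ι a) (ι b) ⟨
  1ℚ + ι a + ι b     ≡⟨ cong (λ q → q + ι b) (ι-suc a) ⟨
  ι (suc a) + ι b    ∎

ι-* : ∀ a b → ι (a ℕ.* b) ≡ ι a * ι b
ι-* zero    b = sym (ℚ.*-zeroˡ (ι b))
ι-* (suc a) b = begin
  ι (b ℕ.+ a ℕ.* b)   ≡⟨ ι-+ b (a ℕ.* b) ⟩
  ι b + ι (a ℕ.* b)   ≡⟨ cong (λ q → ι b + q) (ι-* a b) ⟩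
  ι b + ι a * ι b     ≡⟨ solve 2 (λ u v → v :+ u :* v := (con 1ℚ :+ u) :* v) refl (ι a) (ι b) ⟩
  (1ℚ + ι a) * ι b    ≡⟨ cong (λ q → q * ι b) (ι-suc a) ⟨
  ι (suc a) * ι b     ∎

-- `_/_` reduces to lowest terms, so the comparison passes to unnormalised rationals, where it is a
-- cross-multiplication.
ι-*-/ : ∀ s .{{_ : NonZero s}} m → ι s * (+ m / s) ≡ ι m
ι-*-/ (suc s) m = ℚ.toℚᵘ-injective (begin′
  ℚ.toℚᵘ (ι (suc s) * (+ m / suc s))              ≈⟨ ℚ.toℚᵘ-homo-* (ι (suc s)) (+ m / suc s) ⟩
  ℚ.toℚᵘ (ι (suc s)) ℚᵘ.* ℚ.toℚᵘ (+ m / suc s)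
    ≈⟨ ℚᵘ.*-cong (ℚ.toℚᵘ-fromℚᵘ (ℚᵘ.mkℚᵘ (+ suc s) 0))
                 (ℚ.toℚᵘ-fromℚᵘ (ℚᵘ.mkℚᵘ (+ m) s)) ⟩
  ℚᵘ.mkℚᵘ (+ suc s) 0 ℚᵘ.* ℚᵘ.mkℚᵘ (+ m) s        ≈⟨ ℚᵘ.*≡* cross ⟩
  ℚᵘ.mkℚᵘ (+ m) 0                                 ≈⟨ ℚ.toℚᵘ-fromℚᵘ (ℚᵘ.mkℚᵘ (+ m) 0) ⟨
  ℚ.toℚᵘ (ι m)                                    ∎′)
  where
  open import Relation.Binary.Reasoning.Setoid ℚᵘ.≃-setoid
    renaming (begin_ to begin′_; _∎ to _∎′)
  cross : (+ suc s ℤ.* + m) ℤ.* + 1 ≡ + m ℤ.* + (1 ℕ.* suc s)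
  cross = trans (ℤ.*-identityʳ _)
         (trans (ℤ.*-comm (+ suc s) (+ m))
                (cong (λ d → + m ℤ.* + d) (sym (ℕ.*-identityˡ (suc s)))))

-- Allows identities to be proved with denominators cleared: applied to `ι s` for a single draw and
-- to the whole denominator in the final formula.
*-cancelˡ : ∀ r .{{_ : ℚ.NonZero r}} {a b} → r * a ≡ r * b → a ≡ b
*-cancelˡ r {a} {b} eq = begin
  a                 ≡⟨ undo a ⟨
  1/ r * (r * a)    ≡⟨ cong (λ q → 1/ r * q) eq ⟩
  1/ r * (r * b)    ≡⟨ undo b ⟩
  b                 ∎
  where
  undo : ∀ c → 1/ r * (r * c) ≡ c
  undo c = begin
    1/ r * (r * c)  ≡⟨ ℚ.*-assoc (1/ r) r c ⟨
    1/ r * r * c    ≡⟨ cong (λ q → q * c) (ℚ.*-inverseˡ r) ⟩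
    1ℚ * c          ≡⟨ ℚ.*-identityˡ c ⟩
    c               ∎

-- Finite sums

∑-cong : ∀ (as : List A) {f g : A → ℚ} → (∀ a → f a ≡ g a) → ∑-over as f ≡ ∑-over as g
∑-cong []       f≗g = refl
∑-cong (a ∷ as) f≗g = cong₂ _+_ (f≗g a) (∑-cong as f≗g)

∑-++ : ∀ (as bs : List A) f → ∑-over (as ++ bs) f ≡ ∑-over as f + ∑-over bs f
∑-++ []       bs f = sym (ℚ.+-identityˡ _)
∑-++ (a ∷ as) bs f = trans (cong (λ q → f a + q) (∑-++ as bs f)) (sym (ℚ.+-assoc (f a) _ _))

∑-map : ∀ (g : A → B) as f → ∑-over (List.map g as) f ≡ ∑-over as (f ∘ g)
∑-map g []       f = refl
∑-map g (a ∷ as) f = cong (λ q → f (g a) + q) (∑-map g as f)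

∑-concatMap : ∀ (g : A → List B) as f →
              ∑-over (List.concatMap g as) f ≡ ∑-over as (λ a → ∑-over (g a) f)
∑-concatMap g []       f = refl
∑-concatMap g (a ∷ as) f =
  trans (∑-++ (g a) (List.concatMap g as) f) (cong (λ q → ∑-over (g a) f + q) (∑-concatMap g as f))

∑-*ˡ : ∀ c (as : List A) f → ∑-over as (λ a → c * f a) ≡ c * ∑-over as f
∑-*ˡ c []       f = sym (ℚ.*-zeroʳ c)
∑-*ˡ c (a ∷ as) f =
  trans (cong (λ q → c * f a + q) (∑-*ˡ c as f)) (sym (ℚ.*-distribˡ-+ c (f a) _))

∑-cartesianProductWith : ∀ {C : Set} (_·_ : A → B → C) f g h → (∀ a b → h (a · b) ≡ f a * g b) →
  ∀ as bs → ∑-over (List.cartesianProductWith _·_ as bs) h ≡ ∑-over as f * ∑-over bs g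
∑-cartesianProductWith _·_ f g h h· []       bs = sym (ℚ.*-zeroˡ (∑-over bs g))
∑-cartesianProductWith _·_ f g h h· (a ∷ as) bs = begin
  ∑-over (List.map (a ·_) bs ++ List.cartesianProductWith _·_ as bs) h
    ≡⟨ ∑-++ (List.map (a ·_) bs) _ h ⟩
  ∑-over (List.map (a ·_) bs) h + ∑-over (List.cartesianProductWith _·_ as bs) h
    ≡⟨ cong₂ _+_ (∑-map (a ·_) bs h) (∑-cartesianProductWith _·_ f g h h· as bs) ⟩
  ∑-over bs (λ b → h (a · b)) + ∑-over as f * ∑-over bs g
    ≡⟨ cong (λ q → q + ∑-over as f * ∑-over bs g)
         (trans (∑-cong bs (h· a)) (∑-*ˡ (f a) bs g)) ⟩
  f a * ∑-over bs g + ∑-over as f * ∑-over bs g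
    ≡⟨ ℚ.*-distribʳ-+ (∑-over bs g) (f a) (∑-over as f) ⟨
  (f a + ∑-over as f) * ∑-over bs g ∎

-- Distributivity: since the subsets for different cells are chosen independently, the multiple sum
-- factors into one sum per cell.
∑-choices : ∀ {k} (ass : Vector (List A) k) (f : A → ℚ) →
  ∑-over (choices (tabulate ass)) (λ S → ∏ λ j → f (lookup S j)) ≡ ∏ λ j → ∑-over (ass j) f
∑-choices {k = zero}  ass f = refl
∑-choices {k = suc k} ass f = trans
  (∑-cartesianProductWith Vec._∷_ f _ _ (λ _ _ → refl) (ass zero) (choices (tabulate (ass ∘ suc))))
  (cong (λ q → ∑-over (ass zero) f * q) (∑-choices (ass ∘ suc) f))

-- Expectations

𝔼 : Dist A → (A → ℚ) → ℚ
𝔼 d f = ∑-over d (λ (w , a) → w * f a)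

[_]? : {P : Set} → Dec P → ℚ
[ P? ]? = if does P? then 1ℚ else 0ℚ

Pr≡𝔼 : {P : Pred A 0ℓ} (P? : Decidable P) (d : Dist A) → Pr P? d ≡ 𝔼 d (λ a → [ P? a ]?)
Pr≡𝔼 P? []            = refl
Pr≡𝔼 P? ((w , a) ∷ d) with does (P? a)
... | true  = cong₂ _+_ (sym (ℚ.*-identityʳ w)) (Pr≡𝔼 P? d)
... | false = cong₂ _+_ (sym (ℚ.*-zeroʳ w)) (Pr≡𝔼 P? d)

𝔼-cong : ∀ (d : Dist A) {f g} → (∀ a → f a ≡ g a) → 𝔼 d f ≡ 𝔼 d g
𝔼-cong d f≗g = ∑-cong d (λ (w , a) → cong (λ q → w * q) (f≗g a))

𝔼-return : ∀ (a : A) f → 𝔼 (return a) f ≡ f a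
𝔼-return a f = trans (ℚ.+-identityʳ (1ℚ * f a)) (ℚ.*-identityˡ (f a))

-- The law of total expectation. The weights of a bind are products `v * w`, and the factor `v` is
-- common to the whole block coming from one outcome of `d`.
𝔼->>= : ∀ (d : Dist A) (g : A → Dist B) f → 𝔼 (d >>= g) f ≡ 𝔼 d (λ a → 𝔼 (g a) f)
𝔼->>= d g f = trans (∑-concatMap _ d _) (∑-cong d λ (v , a) →
  trans (∑-map _ (g a) _)
  (trans (∑-cong (g a) (λ (w , b) → ℚ.*-assoc v w (f b)))
         (∑-*ˡ v (g a) _)))

𝔼->>=-return : ∀ (d : Dist A) (g : A → B) f → 𝔼 (d >>= λ a → return (g a)) f ≡ 𝔼 d (f ∘ g)
𝔼->>=-return d g f = trans (𝔼->>= d _ f) (𝔼-cong d (λ a → 𝔼-return (g a) f))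

𝔼-*ʳ : ∀ (d : Dist A) f c → 𝔼 d (λ a → f a * c) ≡ 𝔼 d f * c
𝔼-*ʳ d f c = begin
  𝔼 d (λ a → f a * c)
    ≡⟨ ∑-cong d (λ (w , a) →
         solve 3 (λ u v z → u :* (v :* z) := z :* (u :* v)) refl w (f a) c) ⟩
  ∑-over d (λ (w , a) → c * (w * f a))  ≡⟨ ∑-*ˡ c d _ ⟩
  c * 𝔼 d f                           ≡⟨ ℚ.*-comm c (𝔼 d f) ⟩
  𝔼 d f * c                           ∎

𝔼-uniform : ∀ (as : List⁺.List⁺ A) f →
            ι (List⁺.length as) * 𝔼 (uniform as) f ≡ ∑-over (toList as) f
𝔼-uniform as f = begin
  ι L * 𝔼 (uniform as) f
    ≡⟨ cong (λ q → ι L * q) (∑-map (+ 1 / L ,_) (toList as) (λ (w , a) → w * f a)) ⟩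
  ι L * ∑-over (toList as) (λ a → + 1 / L * f a)
    ≡⟨ cong (λ q → ι L * q) (∑-*ˡ (+ 1 / L) (toList as) f) ⟩
  ι L * (+ 1 / L * ∑-over (toList as) f) ≡⟨ ℚ.*-assoc (ι L) (+ 1 / L) _ ⟨
  ι L * (+ 1 / L) * ∑-over (toList as) f ≡⟨ cong (λ q → q * ∑-over (toList as) f) (ι-*-/ L 1) ⟩
  1ℚ * ∑-over (toList as) f              ≡⟨ ℚ.*-identityˡ _ ⟩
  ∑-over (toList as) f                   ∎
  where L = List⁺.length as

-- Elementary symmetric polynomials

e : ℕ → List ℕ → ℚ
e r as = ∑-over (combinations r as) (ι ∘ product)

-- The combinations are split according to whether they contain `a`.
e-∷ : ∀ r a as → e (suc r) (a ∷ as) ≡ ι a * e r as + e (suc r) as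
e-∷ r a as = trans (∑-++ (List.map (a ∷_) (combinations r as)) _ _)
  (cong (λ q → q + e (suc r) as) (begin
    ∑-over (List.map (a ∷_) (combinations r as)) (ι ∘ product)  ≡⟨ ∑-map (a ∷_) (combinations r as) _ ⟩
    ∑-over (combinations r as) (λ S → ι (a ℕ.* product S))      ≡⟨ ∑-cong (combinations r as) (λ S → ι-* a (product S)) ⟩
    ∑-over (combinations r as) (λ S → ι a * ι (product S))      ≡⟨ ∑-*ˡ (ι a) (combinations r as) _ ⟩
    ι a * e r as                                                ∎))

-- Any combination using the entry 0 has product 0. This entry comes from the first draw, when the
-- cell holds no red ball.
e-0∷ : ∀ r as → e r (0 ∷ as) ≡ e r as
e-0∷ zero    as = refl
e-0∷ (suc r) as = trans (e-∷ r 0 as)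
  (solve 2 (λ u v → con 0ℚ :* u :+ v := v) refl (e r as) (e (suc r) as))

e-vanishes : ∀ {r} as → length as ℕ.< r → e r as ≡ 0ℚ
e-vanishes {suc r} []       _         = refl
e-vanishes {suc r} (a ∷ as) (s≤s l<r) = begin
  e (suc r) (a ∷ as)             ≡⟨ e-∷ r a as ⟩
  ι a * e r as + e (suc r) as
    ≡⟨ cong₂ (λ u v → ι a * u + v) (e-vanishes as l<r)
         (e-vanishes as (ℕ.m<n⇒m<1+n l<r)) ⟩
  ι a * 0ℚ + 0ℚ                  ≡⟨ solve 1 (λ u → u :* con 0ℚ :+ con 0ℚ := con 0ℚ) refl (ι a) ⟩
  0ℚ                             ∎

-- The coefficient of uˣ in ∏_{a ∈ as} (t u + a).
coeff : ℚ → List ℕ → ℕ → ℚ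
coeff t []       zero    = 1ℚ
coeff t []       (suc x) = 0ℚ
coeff t (a ∷ as) zero    = ι a * coeff t as zero
coeff t (a ∷ as) (suc x) = t * coeff t as x + ι a * coeff t as (suc x)

coeff-vanishes : ∀ t as x → length as ℕ.< x → coeff t as x ≡ 0ℚ
coeff-vanishes t []       (suc x) _         = refl
coeff-vanishes t (a ∷ as) (suc x) (s≤s l<x) = begin
  t * coeff t as x + ι a * coeff t as (suc x)
    ≡⟨ cong₂ (λ u v → t * u + ι a * v) (coeff-vanishes t as x l<x)
         (coeff-vanishes t as (suc x) (ℕ.m<n⇒m<1+n l<x)) ⟩
  t * 0ℚ + ι a * 0ℚ
    ≡⟨ solve 2 (λ u v → u :* con 0ℚ :+ v :* con 0ℚ := con 0ℚ) refl t (ι a) ⟩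
  0ℚ ∎

-- In the expansion of the product, `x` factors contribute `t u` and the other `r` contribute their
-- constant terms, which form an `r`-combination of `as`. The induction compares the recursion of
-- `coeff` with `e-∷`.
coeff≡e : ∀ t as x r → x ℕ.+ r ≡ length as → coeff t as x ≡ t ^ x * e r as
coeff≡e t []       zero    zero    _  = refl
coeff≡e t (a ∷ as) zero    (suc r) eq = begin
  ι a * coeff t as 0              ≡⟨ cong (λ q → ι a * q) (coeff≡e t as 0 r r≡) ⟩
  ι a * (1ℚ * e r as)
    ≡⟨ solve 2 (λ u v → u :* (con 1ℚ :* v) := con 1ℚ :* (u :* v :+ con 0ℚ))
         refl (ι a) (e r as) ⟩
  1ℚ * (ι a * e r as + 0ℚ)
    -- `as` has only `r` entries, so the missing summand of `e-∷` is 0 and may be restored.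
    ≡⟨ cong (λ q → 1ℚ * (ι a * e r as + q))
         (e-vanishes as (s≤s (ℕ.≤-reflexive (sym r≡)))) ⟨
  1ℚ * (ι a * e r as + e (suc r) as)  ≡⟨ cong (λ q → 1ℚ * q) (e-∷ r a as) ⟨
  1ℚ * e (suc r) (a ∷ as)         ∎
  where r≡ = ℕ.suc-injective eq
coeff≡e t (a ∷ as) (suc x) zero    eq = begin
  t * coeff t as x + ι a * coeff t as (suc x)
    ≡⟨ cong₂ (λ u v → t * u + ι a * v) (coeff≡e t as x 0 x≡)
         (coeff-vanishes t as (suc x)
           (s≤s (ℕ.≤-reflexive (trans (sym x≡) (ℕ.+-identityʳ x))))) ⟩
  t * (t ^ x * 1ℚ) + ι a * 0ℚ
    ≡⟨ solve 3 (λ u v w → u :* (v :* con 1ℚ) :+ w :* con 0ℚ := u :* v :* con 1ℚ) refl t (t ^ x) (ι a) ⟩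
  t * t ^ x * 1ℚ ∎
  where x≡ = ℕ.suc-injective eq
coeff≡e t (a ∷ as) (suc x) (suc r) eq = begin
  t * coeff t as x + ι a * coeff t as (suc x)
    ≡⟨ cong₂ (λ u v → t * u + ι a * v) (coeff≡e t as x (suc r) x≡)
         (coeff≡e t as (suc x) r (trans (sym (ℕ.+-suc x r)) x≡)) ⟩
  t * (t ^ x * e (suc r) as) + ι a * (t * t ^ x * e r as)
    ≡⟨ solve 5 (λ u v w y z → u :* (v :* y) :+ w :* (u :* v :* z) := u :* v :* (w :* z :+ y))
         refl t (t ^ x) (ι a) (e (suc r) as) (e r as) ⟩
  t * t ^ x * (ι a * e r as + e (suc r) as)
    ≡⟨ cong (λ q → t * t ^ x * q) (e-∷ r a as) ⟨
  t * t ^ x * e (suc r) (a ∷ as) ∎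
  where x≡ = ℕ.suc-injective eq

-- Ranges of consecutive integers and falling factorials.

applyUpTo≡iterate : ∀ (f : ℕ → ℕ) i N → (∀ l → f l ≡ l ℕ.+ i) →
                    List.applyUpTo f N ≡ List.iterate suc i N
applyUpTo≡iterate f i zero    f≗ = refl
applyUpTo≡iterate f i (suc N) f≗ = cong₂ _∷_ (f≗ 0)
  (applyUpTo≡iterate (f ∘ suc) (suc i) N (λ l → trans (f≗ (suc l)) (sym (ℕ.+-suc l i))))

-- `falling` unfolds from its largest factor, but the first draw accounts for the smallest one; this
-- lemma splits off that end.
falling-last : ∀ u N → falling u (suc N) ≡ falling u N * (u - ι N)
falling-last u zero    = solve 1 (λ u → u :* con 1ℚ := con 1ℚ :* (u :- con 0ℚ)) refl u
falling-last u (suc N) = begin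
  u * falling (u - 1ℚ) (suc N)
    ≡⟨ cong (λ q → u * q) (falling-last (u - 1ℚ) N) ⟩
  u * (falling (u - 1ℚ) N * (u - 1ℚ - ι N))
    ≡⟨ solve 3 (λ u f n → u :* (f :* (u :- con 1ℚ :- n)) := u :* f :* (u :- (con 1ℚ :+ n)))
         refl u (falling (u - 1ℚ) N) (ι N) ⟩
  u * falling (u - 1ℚ) N * (u - (1ℚ + ι N))
    ≡⟨ cong (λ q → u * falling (u - 1ℚ) N * (u - q)) (ι-suc N) ⟨
  u * falling (u - 1ℚ) N * (u - ι (suc N)) ∎

-- A single cell

-- The composition of a cell (`m` own and `r` red balls) is expressed through sums over the cell, so
-- the order of the balls in the list is irrelevant.
Contains : ℕ → ℕ → Cell → Set
Contains m r cell = ∀ f → ∑-over (toList cell) f ≡ ι m * f own + ι r * f red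

∑-replicate : ∀ N (a : A) f → ∑-over (List.replicate N a) f ≡ ι N * f a
∑-replicate zero    a f = sym (ℚ.*-zeroˡ (f a))
∑-replicate (suc N) a f = begin
  f a + ∑-over (List.replicate N a) f  ≡⟨ cong (λ q → f a + q) (∑-replicate N a f) ⟩
  f a + ι N * f a                      ≡⟨ solve 2 (λ u v → u :+ v :* u := (con 1ℚ :+ v) :* u) refl (f a) (ι N) ⟩
  (1ℚ + ι N) * f a                     ≡⟨ cong (λ q → q * f a) (ι-suc N) ⟨
  ι (suc N) * f a                      ∎

∑-const-1 : ∀ (as : List A) → ∑-over as (const 1ℚ) ≡ ι (length as)
∑-const-1 []       = refl
∑-const-1 (a ∷ as) = trans (cong (λ q → 1ℚ + q) (∑-const-1 as)) (sym (ι-suc (length as)))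

initialCell-contains : ∀ m .{{_ : NonZero m}} → Contains m 0 (initialCell m)
initialCell-contains (suc m) f = trans (∑-replicate (suc m) own f)
  (solve 2 (λ u v → u := u :+ con 0ℚ :* v) refl (ι (suc m) * f own) (f red))

⁺++-contains : ∀ m r (cell : Cell) s → Contains m r cell →
               Contains m (s ℕ.+ r) (cell List⁺.⁺++ List.replicate s red)
⁺++-contains m r cell s c f = begin
  ∑-over (toList cell ++ List.replicate s red) f
    ≡⟨ ∑-++ (toList cell) (List.replicate s red) f ⟩
  ∑-over (toList cell) f + ∑-over (List.replicate s red) f
    ≡⟨ cong₂ _+_ (c f) (∑-replicate s red f) ⟩
  ι m * f own + ι r * f red + ι s * f red
    ≡⟨ solve 5 (λ u v w y z → u :* y :+ v :* z :+ w :* z := u :* y :+ (w :+ v) :* z)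
         refl (ι m) (ι r) (ι s) (f own) (f red) ⟩
  ι m * f own + (ι s + ι r) * f red
    ≡⟨ cong (λ q → ι m * f own + q * f red) (ι-+ s r) ⟨
  ι m * f own + ι (s ℕ.+ r) * f red ∎

-- After `i` draws the cell holds `m` own and `i * s` red balls. Dividing these counts by `s` gives
-- the weights `θ` and `i`, with sum `θ + i`.
𝔼-uniform-cell : ∀ s .{{_ : NonZero s}} m i cell → Contains m (i ℕ.* s) cell → ∀ f →
  (+ m / s + ι i) * 𝔼 (uniform cell) f ≡ + m / s * f own + ι i * f red
𝔼-uniform-cell s m i cell c f = *-cancelˡ (ι s) {{s≢0}} (begin
  ι s * ((t + ι i) * E)
    ≡⟨ solve 4 (λ s t i E → s :* ((t :+ i) :* E) := (s :* t :* con 1ℚ :+ i :* s :* con 1ℚ) :* E)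
         refl (ι s) t (ι i) E ⟩
  (ι s * t * 1ℚ + ι i * ι s * 1ℚ) * E
    ≡⟨ cong₂ (λ u v → (u * 1ℚ + v * 1ℚ) * E) (ι-*-/ s m) (sym (ι-* i s)) ⟩
  (ι m * 1ℚ + ι (i ℕ.* s) * 1ℚ) * E
    -- The composition of the cell, tested on the constant function 1, gives its number of balls;
    -- the explicit factors `1ℚ` match that instance.
    ≡⟨ cong (λ q → q * E) (trans (sym (c (const 1ℚ))) (∑-const-1 (toList cell))) ⟩
  ι (List⁺.length cell) * E
    ≡⟨ 𝔼-uniform cell f ⟩
  ∑-over (toList cell) f
    ≡⟨ c f ⟩
  ι m * f own + ι (i ℕ.* s) * f red
    ≡⟨ cong₂ (λ u v → u * f own + v * f red) (ι-*-/ s m) (sym (ι-* i s)) ⟨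
  ι s * t * f own + ι i * ι s * f red
    ≡⟨ solve 5 (λ s t i y z → s :* t :* y :+ i :* s :* z := s :* (t :* y :+ i :* z))
         refl (ι s) t (ι i) (f own) (f red) ⟩
  ι s * (t * f own + ι i * f red) ∎)
  where
  t = + m / s
  E = 𝔼 (uniform cell) f
  s≢0 = ℚ.pos⇒nonZero (ι s) {{ℚ.normalize-pos s 1}}

-- Induction on `N` for a cell from which `i` draws have already been made. Either color leads to
-- the same next cell, with `s` more red balls, so conditioning on the next draw, with weights `θ`
-- for own and `i` for red, reproduces the recursion of `coeff` at the entry `i`. The falling
-- factorial is the product of `θ + l` over `i ≤ l < i + N`.
draws-law : ∀ s .{{_ : NonZero s}} m N i cell → Contains m (i ℕ.* s) cell → ∀ x →
  falling (+ m / s + ι i + ι N - 1ℚ) N * 𝔼 (draws s cell N) (λ y → [ y ℕ.≟ x ]?)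
    ≡ coeff (+ m / s) (List.iterate suc i N) x
draws-law s m zero    i cell c zero    = refl
draws-law s m zero    i cell c (suc x) = refl
draws-law s m (suc N) i cell c x = begin
  falling (t + ι i + ι (suc N) - 1ℚ) (suc N) * 𝔼 (draws s cell (suc N)) 1[ x ]
    ≡⟨ cong₂ _*_ split-falling split-draws ⟩
  F * (t + ι i) * 𝔼 (uniform cell) after
    ≡⟨ ℚ.*-assoc F (t + ι i) _ ⟩
  F * ((t + ι i) * 𝔼 (uniform cell) after)
    ≡⟨ cong (λ q → F * q) (𝔼-uniform-cell s m i cell c after) ⟩
  F * (t * after own + ι i * after red)
    ≡⟨ solve 5 (λ F t i y z → F :* (t :* y :+ i :* z) := t :* (F :* y) :+ i :* (F :* z))
         refl F t (ι i) (after own) (after red) ⟩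
  t * (F * after own) + ι i * (F * after red)
    ≡⟨ recurse x ⟩
  coeff t (i ∷ as) x ∎
  where
  t = + m / s
  as = List.iterate suc (suc i) N
  cell′ = cell List⁺.⁺++ List.replicate s red
  F = falling (t + ι (suc i) + ι N - 1ℚ) N

  1[_] : ℕ → ℕ → ℚ
  1[ x ] y = [ y ℕ.≟ x ]?

  after : Ball → ℚ
  after b = 𝔼 (draws s cell′ N) (λ y → 1[ x ] (#own b ℕ.+ y))

  split-falling : falling (t + ι i + ι (suc N) - 1ℚ) (suc N) ≡ F * (t + ι i)
  split-falling = trans (falling-last (t + ι i + ι (suc N) - 1ℚ) N)
    (cong₂ (λ u v → falling u N * v)
      (trans (cong (λ q → t + ι i + q - 1ℚ) (ι-suc N))
        (trans
          (solve 3 (λ t i n → t :+ i :+ (con 1ℚ :+ n) :- con 1ℚ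
                           := t :+ (con 1ℚ :+ i) :+ n :- con 1ℚ) refl t (ι i) (ι N))
          (cong (λ q → t + q + ι N - 1ℚ) (sym (ι-suc i)))))
      (trans (cong (λ q → t + ι i + q - 1ℚ - ι N) (ι-suc N))
        (solve 3 (λ t i n → t :+ i :+ (con 1ℚ :+ n) :- con 1ℚ :- n := t :+ i)
           refl t (ι i) (ι N))))

  split-draws : 𝔼 (draws s cell (suc N)) 1[ x ] ≡ 𝔼 (uniform cell) after
  split-draws = trans
    (𝔼->>= (uniform cell) (λ b → draws s cell′ N >>= λ y → return (#own b ℕ.+ y)) 1[ x ])
    (𝔼-cong (uniform cell) (λ b → 𝔼->>=-return (draws s cell′ N) (#own b ℕ.+_) 1[ x ]))

  ih : ∀ x → F * 𝔼 (draws s cell′ N) 1[ x ] ≡ coeff t as x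
  ih = draws-law s m N (suc i) cell′ (⁺++-contains m (i ℕ.* s) cell s c)

  recurse : ∀ x →
    t * (F * 𝔼 (draws s cell′ N) (λ y → 1[ x ] (suc y))) + ι i * (F * 𝔼 (draws s cell′ N) 1[ x ])
      ≡ coeff t (i ∷ as) x
  recurse zero    = begin
    t * (F * Z) + ι i * (F * 𝔼 (draws s cell′ N) 1[ 0 ])
      -- After an own ball the count cannot be 0, so the indicator is constantly 0. As `0ℚ * 0ℚ`
      -- computes to `0ℚ`, pulling out a factor gives `Z ≡ Z * 0ℚ`.
      ≡⟨ cong₂ (λ u v → t * (F * u) + ι i * v) (𝔼-*ʳ (draws s cell′ N) (const 0ℚ) 0ℚ) (ih 0) ⟩
    t * (F * (Z * 0ℚ)) + ι i * coeff t as 0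
      ≡⟨ solve 4 (λ t F Z v → t :* (F :* (Z :* con 0ℚ)) :+ v := v)
           refl t F Z (ι i * coeff t as 0) ⟩
    ι i * coeff t as 0 ∎
    where Z = 𝔼 (draws s cell′ N) (const 0ℚ)
  -- The indicator of `suc y` at `suc x` computes to that of `y` at `x`, so the induction hypothesis
  -- applies directly to the own branch.
  recurse (suc x) = cong₂ (λ u v → t * u + ι i * v) (ih x) (ih (suc x))

cell-law : ∀ s .{{_ : NonZero s}} m .{{_ : NonZero m}} x N → 1 ≤ x → x ≤ N →
  falling (+ m / s + ι N - 1ℚ) N * Pr (ℕ._≟ x) (draws s (initialCell m) N)
    ≡ (+ m / s) ^ x * e (N ∸ x) [1⋯ N ∸ 1 ]
-- From `1 ≤ x ≤ N` the number of draws is positive, so `N ∸ 1` is exact below and the range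
-- `0, …, N - 1` has the head 0.
cell-law s m x zero    (s≤s _) ()
cell-law s m x N@(suc M) _ x≤N = begin
  falling (t + ι N - 1ℚ) N * Pr (ℕ._≟ x) (draws s (initialCell m) N)
    ≡⟨ cong₂ (λ u v → falling (u + ι N - 1ℚ) N * v) (sym (ℚ.+-identityʳ t))
         (Pr≡𝔼 (ℕ._≟ x) (draws s (initialCell m) N)) ⟩
  falling (t + ι 0 + ι N - 1ℚ) N * 𝔼 (draws s (initialCell m) N) (λ y → [ y ℕ.≟ x ]?)
    ≡⟨ draws-law s m N 0 (initialCell m) (initialCell-contains m) x ⟩
  coeff t (List.iterate suc 0 N) x
    ≡⟨ coeff≡e t (List.iterate suc 0 N) x (N ∸ x)
         (trans (ℕ.m+[n∸m]≡n x≤N) (sym (length-iterate suc 0 N))) ⟩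
  t ^ x * e (N ∸ x) (0 ∷ List.iterate suc 1 M)
    ≡⟨ cong (λ q → t ^ x * q) (e-0∷ (N ∸ x) (List.iterate suc 1 M)) ⟩
  t ^ x * e (N ∸ x) (List.iterate suc 1 M)
    ≡⟨ cong (λ as → t ^ x * e (N ∸ x) as) (applyUpTo≡iterate suc 1 M (λ l → ℕ.+-comm 1 l)) ⟨
  t ^ x * e (N ∸ x) [1⋯ M ] ∎
  where t = + m / s

-- Several cells

∏-cong : ∀ {k} {f g : Vector ℚ k} → (∀ j → f j ≡ g j) → ∏ f ≡ ∏ g
∏-cong = sum-cong-≗ ℚ.*-1-monoid

∏-distrib-* : ∀ {k} (f g : Vector ℚ k) → (∏ λ j → f j * g j) ≡ ∏ f * ∏ g
∏-distrib-* = ∑-distrib-+ ℚ.*-1-commutativeMonoid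

[×-dec]? : ∀ {P Q : Set} (P? : Dec P) (Q? : Dec Q) → [ P? ×-dec Q? ]? ≡ [ P? ]? * [ Q? ]?
[×-dec]? P? Q? with does P? | does Q?
... | true  | true  = refl
... | true  | false = refl
... | false | true  = refl
... | false | false = refl

-- The later cells depend on the first one only through its count. On the event considered this
-- count is `x zero`, so the number of remaining draws is fixed and the probability factors.
experiment-law : ∀ {k} s (cells : Vector Cell k) x n →
  Pr (λ y → ≡-dec ℕ._≟_ y (tabulate x)) (experiment s (tabulate cells) n)
    ≡ ∏ λ j → Pr (ℕ._≟ x j) (draws s (cells j) (n ∸ Σ< x j))
experiment-law {zero}  s cells x n = refl
experiment-law {suc k} s cells x n = begin
  Pr (λ y → ≡-dec ℕ._≟_ y (tabulate x)) (experiment s (tabulate cells) n)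
    ≡⟨ Pr≡𝔼 _ (experiment s (tabulate cells) n) ⟩
  𝔼 (experiment s (tabulate cells) n) (λ y → [ ≡-dec ℕ._≟_ y (tabulate x) ]?)
    ≡⟨ 𝔼->>= d _ _ ⟩
  𝔼 d (λ a → 𝔼 (rest (n ∸ a) >>= λ ys → return (a Vec.∷ ys)) (λ y → [ ≡-dec ℕ._≟_ y (tabulate x) ]?))
    ≡⟨ 𝔼-cong d (λ a → 𝔼->>=-return (rest (n ∸ a)) (a Vec.∷_) _) ⟩
  -- The equality test on nonempty vectors computes to the conjunction of the tests on head and
  -- tail.
  𝔼 d (λ a → 𝔼 (rest (n ∸ a)) (λ ys → [ (a ℕ.≟ x zero) ×-dec ≡-dec ℕ._≟_ ys (tabulate x′) ]?))
    ≡⟨ 𝔼-cong d split ⟩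
  𝔼 d (λ a → [ a ℕ.≟ x zero ]? * Pr tail? (rest (n ∸ x zero)))
    ≡⟨ 𝔼-*ʳ d _ _ ⟩
  𝔼 d (λ a → [ a ℕ.≟ x zero ]?) * Pr tail? (rest (n ∸ x zero))
    ≡⟨ cong₂ _*_ (sym (Pr≡𝔼 (ℕ._≟ x zero) d)) (experiment-law s (cells ∘ suc) x′ (n ∸ x zero)) ⟩
  Pr (ℕ._≟ x zero) d * (∏ λ j → Pr (ℕ._≟ x′ j) (draws s (cells (suc j)) (n ∸ x zero ∸ Σ< x′ j)))
    ≡⟨ cong (λ q → Pr (ℕ._≟ x zero) d * q) (∏-cong λ j →
         cong (λ N → Pr (ℕ._≟ x′ j) (draws s (cells (suc j)) N)) (ℕ.∸-+-assoc n (x zero) (Σ< x′ j))) ⟩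
  (∏ λ j → Pr (ℕ._≟ x j) (draws s (cells j) (n ∸ Σ< x j))) ∎
  where
  d = draws s (cells zero) n
  rest = experiment s (tabulate (cells ∘ suc))
  x′ = x ∘ suc

  tail? : Decidable (_≡ tabulate x′)
  tail? ys = ≡-dec ℕ._≟_ ys (tabulate x′)

  split : ∀ a → 𝔼 (rest (n ∸ a)) (λ ys → [ (a ℕ.≟ x zero) ×-dec tail? ys ]?)
              ≡ [ a ℕ.≟ x zero ]? * Pr tail? (rest (n ∸ x zero))
  split a = begin
    𝔼 (rest (n ∸ a)) (λ ys → [ (a ℕ.≟ x zero) ×-dec tail? ys ]?)
      ≡⟨ 𝔼-cong (rest (n ∸ a)) (λ ys →
           trans ([×-dec]? (a ℕ.≟ x zero) (tail? ys)) (ℚ.*-comm [ a ℕ.≟ x zero ]? _)) ⟩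
    𝔼 (rest (n ∸ a)) (λ ys → [ tail? ys ]? * [ a ℕ.≟ x zero ]?)
      ≡⟨ 𝔼-*ʳ (rest (n ∸ a)) _ _ ⟩
    𝔼 (rest (n ∸ a)) (λ ys → [ tail? ys ]?) * [ a ℕ.≟ x zero ]?
      ≡⟨ ℚ.*-comm _ [ a ℕ.≟ x zero ]? ⟩
    [ a ℕ.≟ x zero ]? * 𝔼 (rest (n ∸ a)) (λ ys → [ tail? ys ]?)
      ≡⟨ cong (λ q → [ a ℕ.≟ x zero ]? * q) (Pr≡𝔼 tail? (rest (n ∸ a))) ⟨
    [ a ℕ.≟ x zero ]? * Pr tail? (rest (n ∸ a))
      -- The indicator permits replacing `a` by `x zero`: where they differ, both sides are 0.
      ≡⟨ at-hit (a ℕ.≟ x zero) ⟩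
    [ a ℕ.≟ x zero ]? * Pr tail? (rest (n ∸ x zero)) ∎
    where
    at-hit : (a? : Dec (a ≡ x zero)) →
      [ a? ]? * Pr tail? (rest (n ∸ a)) ≡ [ a? ]? * Pr tail? (rest (n ∸ x zero))
    at-hit (yes refl) = refl
    at-hit (no _)     = trans (ℚ.*-zeroˡ (Pr tail? (rest (n ∸ a))))
                              (sym (ℚ.*-zeroˡ (Pr tail? (rest (n ∸ x zero)))))

-- Partial sums of the counts and assembly of the formula.

Σ≤≡Σ<+ : ∀ {k} (x : Vector ℕ k) j → Σ≤ x j ≡ Σ< x j ℕ.+ x j
Σ≤≡Σ<+ x zero    = ℕ.+-identityʳ (x zero)
Σ≤≡Σ<+ x (suc j) = trans (cong (x zero ℕ.+_) (Σ≤≡Σ<+ (x ∘ suc) j))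
                         (sym (ℕ.+-assoc (x zero) (Σ< (x ∘ suc) j) (x (suc j))))

Σ≤-≤-total : ∀ {k} (x : Vector ℕ k) j → Σ≤ x j ≤ total x
Σ≤-≤-total x zero    = ℕ.+-monoʳ-≤ (x zero) z≤n
Σ≤-≤-total x (suc j) = ℕ.+-monoʳ-≤ (x zero) (Σ≤-≤-total (x ∘ suc) j)

mainTheorem1 : (k n s : ℕ) → 1 ≤ k → 1 ≤ n → .{{_ : NonZero s}} →
    (m : Vector ℕ k) (m≢0 : ∀ j → NonZero (m j)) →
    (x : Vector ℕ k) → (∀ j → 1 ≤ x j) → total x ≤ n →
    p s m m≢0 x n
    ≡ ((∏ λ j → θ s m j ^ x j) ÷ denominator s m x n) {{denominator≢0 s m m≢0 x n}}
    * ∑-over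
    (choices (tabulate λ j → combinations (n ∸ Σ≤ x j) [1⋯ n ∸ Σ< x j ∸ 1 ]))
    (λ S → ∏ λ j → ι (product (lookup S j)))
mainTheorem1 k n s 1≤k 1≤n m m≢0 x 1≤x total≤n = *-cancelˡ D {{D≢0}} (begin
  D * p s m m≢0 x n
    ≡⟨ cong (λ q → D * q) (experiment-law s _ x n) ⟩
  D * (∏ λ j → P j)
    ≡⟨ ∏-distrib-* _ P ⟨
  (∏ λ j → falling (θ s m j + ι (n ∸ Σ< x j) - 1ℚ) (n ∸ Σ< x j) * P j)
    ≡⟨ ∏-cong cell ⟩
  (∏ λ j → θ s m j ^ x j * e (n ∸ Σ≤ x j) [1⋯ n ∸ Σ< x j ∸ 1 ])
    ≡⟨ ∏-distrib-* (λ j → θ s m j ^ x j) _ ⟩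
  T * (∏ λ j → e (n ∸ Σ≤ x j) [1⋯ n ∸ Σ< x j ∸ 1 ])
    ≡⟨ cong (λ q → T * q)
         (∑-choices (λ j → combinations (n ∸ Σ≤ x j) [1⋯ n ∸ Σ< x j ∸ 1 ]) (ι ∘ product)) ⟨
  T * S
    ≡⟨ cong (λ q → q * S) (ℚ.*-identityʳ T) ⟨
  T * 1ℚ * S
    -- The 1 is expanded to `D * 1/D` so that the quotient `T ÷ D` appears behind a factor `D`,
    -- which is then cancelled.
    ≡⟨ cong (λ q → T * q * S) (ℚ.*-inverseʳ D {{D≢0}}) ⟨
  T * (D * 1/D) * S
    ≡⟨ solve 4 (λ T D r S → T :* (D :* r) :* S := D :* (T :* r :* S)) refl T D 1/D S ⟩
  D * (T * 1/D * S) ∎)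
  where
  D = denominator s m x n
  D≢0 = denominator≢0 s m m≢0 x n
  1/D = (1/ D) {{D≢0}}
  T = ∏ λ j → θ s m j ^ x j
  S = ∑-over (choices (tabulate λ j → combinations (n ∸ Σ≤ x j) [1⋯ n ∸ Σ< x j ∸ 1 ]))
             (λ S → ∏ λ j → ι (product (lookup S j)))
  P : Vector ℚ k
  P j = Pr (ℕ._≟ x j) (draws s (initialCell (m j) {{m≢0 j}}) (n ∸ Σ< x j))

  cell : ∀ j → falling (θ s m j + ι (n ∸ Σ< x j) - 1ℚ) (n ∸ Σ< x j) * P j
             ≡ θ s m j ^ x j * e (n ∸ Σ≤ x j) [1⋯ n ∸ Σ< x j ∸ 1 ]
  cell j = trans
    (cell-law s (m j) {{m≢0 j}} (x j) (n ∸ Σ< x j) (1≤x j)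
      -- The count `x j` does not exceed the number of draws from its cell, because
      -- `Σ< x j + x j = Σ≤ x j ≤ total x ≤ n`.
      (ℕ.m+n≤o⇒m≤o∸n (x j)
        (ℕ.≤-trans (ℕ.≤-reflexive (trans (ℕ.+-comm (x j) (Σ< x j)) (sym (Σ≤≡Σ<+ x j))))
                   (ℕ.≤-trans (Σ≤-≤-total x j) total≤n))))
    (cong (λ r → θ s m j ^ x j * e r [1⋯ n ∸ Σ< x j ∸ 1 ])
      (trans (ℕ.∸-+-assoc n (Σ< x j) (x j)) (cong (n ∸_) (sym (Σ≤≡Σ<+ x j)))))
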